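{- Let $\kappa\ge 2$. There exists $n_0$ such that the following holds for every $n\ge n_0$. Let $G$ be a graph with $n$ vertices and $m$ edges, where $t_\kappa(n)+1\le m\le t_{\kappa+1}(n)$, and let $F$ be a maximum chordal subgraph of $G$. Then $F$ contains a clique on $\kappa+1$ vertices.
   Context: $t_\kappa(n)$ denotes the maximum number of edges in a graph on $n$ vertices containing no clique on $\kappa+1$ vertices (the Turán number). A graph is chordal if every cycle of length at least $4$ has a chord. A maximum chordal subgraph of $G$ is a chordal subgraph of $G$ with the largest possible number of edges. -}

module Defs where

open import Data.Nat using (ℕ; zero; suc; _+_; _≤_; _<_; _<ᵇ_; _%_)
open import Data.Fin using (Fin; toℕ)
open import Data.Bool using (Bool; true; false; _∧_; if_then_else_)
open import Data.List using (List; map; allFin)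
open import Data.Nat.ListAction using (sum)
open import Data.Product using (Σ; ∃; _×_; _,_)
open import Data.Sum using (_⊎_)
open import Function.Definitions using (Injective)
open import Relation.Binary.PropositionalEquality using (_≡_; _≢_)
open import Relation.Nullary using (¬_)

record Graph (n : ℕ) : Set where
  field
    adj    : Fin n → Fin n → Bool
    sym    : ∀ i j → adj i j ≡ adj j i
    irrefl : ∀ i → adj i i ≡ false
open Graph public

Adj : ∀ {n} → Graph n → Fin n → Fin n → Set
Adj G i j = adj G i j ≡ true

edges : ∀ {n} → Graph n → ℕ
edges {n} G =
  sum (map (λ i → sum (map (λ j → if (toℕ i <ᵇ toℕ j) ∧ adj G i j then 1 else 0)
                           (allFin n)))
           (allFin n))

HasClique : ∀ {n} → ℕ → Graph n → Set
HasClique {n} k G =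
  Σ (Fin k → Fin n) λ f → Injective _≡_ _≡_ f × (∀ a b → a ≢ b → Adj G (f a) (f b))

IsTuranNumber : ℕ → ℕ → ℕ → Set
IsTuranNumber κ n t =
  (Σ (Graph n) λ H → ¬ HasClique (suc κ) H × edges H ≡ t)
  × (∀ (H : Graph n) → ¬ HasClique (suc κ) H → edges H ≤ t)

Consecutive : (k : ℕ) → Fin (suc k) → Fin (suc k) → Set
Consecutive k a b =
  toℕ b ≡ (suc (toℕ a)) % (suc k) ⊎ toℕ a ≡ (suc (toℕ b)) % (suc k)

IsCycle : ∀ {n} (G : Graph n) (k : ℕ) → (Fin (suc k) → Fin n) → Set
IsCycle G k c =
  Injective _≡_ _≡_ c × (∀ a b → Consecutive k a b → Adj G (c a) (c b))

Chordal : ∀ {n} → Graph n → Set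
Chordal {n} G =
  ∀ (k : ℕ) → 3 ≤ k → (c : Fin (suc k) → Fin n) → IsCycle G k c →
  Σ (Fin (suc k)) λ a → Σ (Fin (suc k)) λ b →
    a ≢ b × ¬ Consecutive k a b × Adj G (c a) (c b)

Subgraph : ∀ {n} → Graph n → Graph n → Set
Subgraph F G = ∀ i j → Adj F i j → Adj G i j

IsMaxChordalSubgraph : ∀ {n} → Graph n → Graph n → Set
IsMaxChordalSubgraph {n} F G =
  Subgraph F G × Chordal F
  × (∀ (F' : Graph n) → Subgraph F' G → Chordal F' → edges F' ≤ edges F)

{-# OPTIONS --safe #-}
module Submission where

-- Choose v₁, v₂, … greedily, each of maximum degree among the common neighbours of its predecessors,
-- and write aᵢ = n − deg vᵢ. If a₁ + … + aⱼ ≥ n for some j ≤ κ, the complete j-partite graph with parts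
-- a₁, …, aⱼ₋₁ and the remaining vertices has at least as many edges as G, contradicting e(G) > t_κ(n).
-- Hence v₁, …, v_κ exist, form a clique and have degree sum greater than (κ − 1)n. The edges of G that
-- meet this clique form a chordal graph with more than (κ − 1)n − κ(κ − 1)/2 edges, whereas by Dirac's
-- theorem a chordal graph without a clique on κ + 1 vertices has at most that many.

-- Let W be the set of common neighbours of the predecessors of vᵢ. By the choice of vᵢ every vertex
-- of W has at least aᵢ non-neighbours, itself included. If all aᵢ non-neighbours of vᵢ lay in W,
-- they would account for at least aᵢ² ordered non-adjacent pairs, which is what a part of size aᵢ
-- costs in the multipartite graph. The obstacle is that some of them may have left W earlier. Then
-- W shrinks by less than aᵢ, and the deficit has to be charged to vertices that stay in W; their
-- codegrees are at least aᵢ as well. This is why the induction carries a surplus. The final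
-- comparison has no slack beyond one strict inequality: κ(κ - 1)/2 is both the number of edges
-- inside the clique, which its degree sum counts twice, and the amount by which a (κ - 1)-tree
-- falls short of (κ - 1)n edges. Edges are counted as ordered pairs throughout, so no halves occur.

open import Defs
open import Data.Bool using (Bool; true; false; not; _∧_; _∨_; if_then_else_)
import Data.Bool.Properties as Bool
open import Data.Empty using (⊥; ⊥-elim)
open import Data.Fin using (Fin; zero; suc; toℕ; fromℕ; splitAt; _↑ˡ_; _↑ʳ_)
open import Data.Fin.Patterns using (0F; 1F; 2F; 3F)
open import Data.Fin.Properties using (any?; _≟_; suc-injective; toℕ-injective; toℕ<n; toℕ-fromℕ; pigeonhole; splitAt-↑ˡ; splitAt-↑ʳ)
import Data.Fin.Properties as Fin
open import Data.List using (List; []; _∷_; length; map; allFin; tabulate)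
open import Data.List.Properties using (map-tabulate)
open import Data.Nat hiding (_≟_)
open import Data.Nat.DivMod using (m<n⇒m%n≡m; n%n≡0)
import Data.Nat.ListAction as List
open import Data.Nat.Properties hiding (_≟_; suc-injective)
open import Data.Nat.Tactic.RingSolver using (solve-∀)
open import Data.Product using (Σ; ∃; _×_; _,_; proj₁; proj₂)
open import Data.Sum using (_⊎_; inj₁; inj₂; swap; [_,_]′)
open import Function using (_∘_; id; const)
open import Function.Definitions using (Injective)
open import Relation.Binary.Construct.Closure.ReflexiveTransitive as Star using (Star; ε; _◅_; _◅◅_)
open import Relation.Binary.Definitions using (tri<; tri≈; tri>)
open import Relation.Binary.PropositionalEquality using (_≡_; _≢_; refl; cong; cong₂; trans; subst; subst₂; module ≡-Reasoning) renaming (sym to ≡-sym)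
open import Relation.Nullary using (¬_; Dec; yes; no; does; ¬?; _×-dec_; contradiction)
open import Relation.Nullary.Decidable using (dec-true; dec-false)
open import Algebra.Properties.Semiring.Sum +-*-semiring using (sum; sum-cong-≗; ∑-distrib-+; ∑-comm; *-distribˡ-sum; *-distribʳ-sum)

-- Sums and cardinalities over Fin n

variable
  n : ℕ

⟦_⟧ : Bool → ℕ
⟦ b ⟧ = if b then 1 else 0

card : (Fin n → Bool) → ℕ
card P = sum λ i → ⟦ P i ⟧

is : Fin n → Fin n → Bool
is v i = does (i ≟ v)

is-refl : (v : Fin n) → is v v ≡ true
is-refl zero    = refl
is-refl (suc v) = is-refl v

is⇒≡ : (v i : Fin n) → is v i ≡ true → i ≡ v
is⇒≡ zero    zero    _ = refl
is⇒≡ (suc v) (suc i) e = cong suc (is⇒≡ v i e)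

sum-mono-≤ : {f g : Fin n → ℕ} → (∀ i → f i ≤ g i) → sum f ≤ sum g
sum-mono-≤ {zero}  h = z≤n
sum-mono-≤ {suc n} h = +-mono-≤ (h zero) (sum-mono-≤ (h ∘ suc))

sum-mono-< : {f g : Fin n → ℕ} → (∀ i → f i ≤ g i) → (v : Fin n) → f v < g v → sum f < sum g
sum-mono-< h zero    l = +-mono-<-≤ l (sum-mono-≤ (h ∘ suc))
sum-mono-< h (suc v) l = +-mono-≤-< (h zero) (sum-mono-< (h ∘ suc) v l)

sum-const : (c : ℕ) → sum {n} (λ _ → c) ≡ n * c
sum-const {zero}  c = refl
sum-const {suc n} c = cong (c +_) (sum-const {n} c)

sum-zero : sum {n} (λ _ → 0) ≡ 0
sum-zero {n} = trans (sum-const {n} 0) (*-zeroʳ n)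

sum-is : (v : Fin n) (g : Fin n → ℕ) → sum (λ i → ⟦ is v i ⟧ * g i) ≡ g v
sum-is {suc n} zero g = trans (cong₂ _+_ (+-identityʳ (g zero)) (sum-zero {n})) (+-identityʳ _)
sum-is (suc v) g = sum-is v (g ∘ suc)

sum-is² : (v : Fin n) (g : Fin n → Fin n → ℕ) → sum (λ i → sum (λ j → ⟦ is v i ⟧ * g i j)) ≡ sum (g v)
sum-is² v g =
  trans (sum-cong-≗ λ i → ≡-sym (*-distribˡ-sum ⟦ is v i ⟧ (g i))) (sum-is v (λ i → sum (g i)))

⟦⟧-mono : (a b : Bool) → (a ≡ true → b ≡ true) → ⟦ a ⟧ ≤ ⟦ b ⟧
⟦⟧-mono false b h = z≤n
⟦⟧-mono true  b h rewrite h refl = ≤-refl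

card-mono : {P Q : Fin n → Bool} → (∀ i → P i ≡ true → Q i ≡ true) → card P ≤ card Q
card-mono h = sum-mono-≤ λ i → ⟦⟧-mono _ _ (h i)

card-mono-< : {P Q : Fin n → Bool} → (∀ i → P i ≡ true → Q i ≡ true) →
              (v : Fin n) → P v ≡ false → Q v ≡ true → card P < card Q
card-mono-< {P = P} {Q} h v p q = sum-mono-< (λ i → ⟦⟧-mono _ _ (h i)) v lt
  where
  lt : ⟦ P v ⟧ < ⟦ Q v ⟧
  lt rewrite p | q = ≤-refl

card-full : card {n} (λ _ → true) ≡ n
card-full {n} = trans (sum-const {n} 1) (*-identityʳ n)

card-pick : (P : Fin n → Bool) (k : ℕ) → k ≤ card P →
            Σ (Fin k → Fin n) λ f → Injective _≡_ _≡_ f × (∀ i → P (f i) ≡ true)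
card-pick P zero _ = (λ ()) , (λ { {()} }) , (λ ())
card-pick {suc n} P (suc k) h with P zero in eq
... | false with f , inj , f∈P ← card-pick (P ∘ suc) (suc k) h =
  suc ∘ f , inj ∘ suc-injective , f∈P
... | true with f , inj , f∈P ← card-pick (P ∘ suc) k (s≤s⁻¹ h) =
  g , g-inj , g∈P
  where
  g : Fin (suc k) → Fin (suc n)
  g zero    = zero
  g (suc i) = suc (f i)
  g-inj : Injective _≡_ _≡_ g
  g-inj {zero}  {zero}  _ = refl
  g-inj {suc i} {suc j} e = cong suc (inj (suc-injective e))
  g∈P : ∀ i → P (g i) ≡ true
  g∈P zero    = eq
  g∈P (suc i) = f∈P i

card-nonempty : (P : Fin n → Bool) → 0 < card P → ∃ λ v → P v ≡ true
card-nonempty P h with f , _ , f∈P ← card-pick P 1 h = f zero , f∈P zero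

argmin : (P : Fin n → Bool) (g : Fin n → ℕ) → (∃ λ v → P v ≡ true) →
         ∃ λ v → P v ≡ true × (∀ w → P w ≡ true → g v ≤ g w)
argmin {suc n} P g (v , v∈P) with any? (λ i → P (suc i) Bool.≟ true)
... | no none = zero , P0 v v∈P , least
  where
  P0 : ∀ v → P v ≡ true → P zero ≡ true
  P0 zero    e = e
  P0 (suc v) e = ⊥-elim (none (v , e))
  least : ∀ w → P w ≡ true → g zero ≤ g w
  least zero    _ = ≤-refl
  least (suc w) e = ⊥-elim (none (w , e))
... | yes some with argmin (P ∘ suc) (g ∘ suc) some | P zero in eq
...   | m , m∈P , least | false = suc m , m∈P , least′
  where
  least′ : ∀ w → P w ≡ true → g (suc m) ≤ g w
  least′ zero    e with () ← trans (≡-sym eq) e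
  least′ (suc w) e = least w e
...   | m , m∈P , least | true with ≤-total (g zero) (g (suc m))
...     | inj₁ le = zero , eq , λ { zero _ → ≤-refl ; (suc w) e → ≤-trans le (least w e) }
...     | inj₂ ge = suc m , m∈P , λ { zero _ → ge ; (suc w) e → least w e }

sum-allFin : (f : Fin n → ℕ) → List.sum (map f (allFin n)) ≡ sum f
sum-allFin f = trans (cong List.sum (map-tabulate id f)) (sum-tabulate f)
  where
  sum-tabulate : ∀ {n} (f : Fin n → ℕ) → List.sum (tabulate f) ≡ sum f
  sum-tabulate {zero}  f = refl
  sum-tabulate {suc n} f = cong (f zero +_) (sum-tabulate (f ∘ suc))

-- `adj` is irreflexive, so `codeg` counts the vertex itself. It is thus the n - deg of the
-- overview, and in a complete multipartite graph it is the size of the vertex's own part.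
deg codeg : Graph n → Fin n → ℕ
deg   G i = sum λ j → ⟦ adj G i j ⟧
codeg G i = sum λ j → ⟦ not (adj G i j) ⟧

edges-double : (G : Graph n) → edges G + edges G ≡ sum (deg G)
edges-double {n} G = begin
  edges G + edges G                      ≡⟨ cong₂ _+_ edges-< edges-> ⟩
  sum (λ i → sum (a i)) + sum (λ i → sum λ j → a j i)
                                         ≡⟨ ∑-distrib-+ (λ i → sum (a i)) (λ i → sum λ j → a j i) ⟨
  sum (λ i → sum (a i) + sum λ j → a j i)
                                         ≡⟨ sum-cong-≗ (λ i → ≡-sym (∑-distrib-+ (a i) (λ j → a j i))) ⟩
  sum (λ i → sum λ j → a i j + a j i)    ≡⟨ sum-cong-≗ (λ i → sum-cong-≗ (split i)) ⟩
  sum (deg G)                            ∎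
  where
  open ≡-Reasoning
  a : Fin n → Fin n → ℕ
  a i j = ⟦ (toℕ i <ᵇ toℕ j) ∧ adj G i j ⟧
  edges-< : edges G ≡ sum (λ i → sum (a i))
  edges-< = trans (sum-allFin {n} _) (sum-cong-≗ λ i → sum-allFin (a i))
  edges-> : edges G ≡ sum (λ i → sum λ j → a j i)
  edges-> = trans edges-< (∑-comm a)
  <ᵇ-true : ∀ {k l} → k < l → (k <ᵇ l) ≡ true
  <ᵇ-true {zero}  {suc l} _ = refl
  <ᵇ-true {suc k} {suc l} p = <ᵇ-true (s≤s⁻¹ p)
  <ᵇ-false : ∀ {k l} → l ≤ k → (k <ᵇ l) ≡ false
  <ᵇ-false {k}     {zero}  _ = refl
  <ᵇ-false {suc k} {suc l} p = <ᵇ-false (s≤s⁻¹ p)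
  split : ∀ i j → a i j + a j i ≡ ⟦ adj G i j ⟧
  split i j with <-cmp (toℕ i) (toℕ j)
  ... | tri< i<j _ _ rewrite <ᵇ-true i<j | <ᵇ-false (<⇒≤ i<j) = +-identityʳ _
  ... | tri> _ _ j<i rewrite <ᵇ-true j<i | <ᵇ-false (<⇒≤ j<i) | sym G i j = refl
  ... | tri≈ _ e _ with refl ← toℕ-injective e
                   rewrite irrefl G i | <ᵇ-false (≤-refl {toℕ i}) = refl

deg+codeg : (G : Graph n) (i : Fin n) → deg G i + codeg G i ≡ n
deg+codeg {n} G i = begin
  deg G i + codeg G i ≡⟨ ∑-distrib-+ (λ j → ⟦ adj G i j ⟧) (λ j → ⟦ not (adj G i j) ⟧) ⟨
  sum (λ j → ⟦ adj G i j ⟧ + ⟦ not (adj G i j) ⟧) ≡⟨ sum-cong-≗ (λ j → lem (adj G i j)) ⟩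
  card {n} (λ _ → true) ≡⟨ card-full ⟩
  n ∎
  where
  open ≡-Reasoning
  lem : ∀ b → ⟦ b ⟧ + ⟦ not b ⟧ ≡ 1
  lem false = refl
  lem true  = refl

-- Simplicial vertices of chordal graphs

true≢false : {b : Bool} → b ≡ true → b ≡ false → ⊥
true≢false refl ()

≢true⇒false : {b : Bool} → ¬ b ≡ true → b ≡ false
≢true⇒false {false} _ = refl
≢true⇒false {true}  h = contradiction refl h

≢false⇒true : {b : Bool} → ¬ b ≡ false → b ≡ true
≢false⇒true {true}  _ = refl
≢false⇒true {false} h = contradiction refl h

does-true : {P : Set} (P? : Dec P) → does P? ≡ true → P
does-true (yes p) _ = p

∨-split : {a b : Bool} → a ∨ b ≡ true → a ≡ true ⊎ b ≡ true
∨-split {true}  _ = inj₁ refl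
∨-split {false} e = inj₂ e

∨-introˡ : {a b : Bool} → a ≡ true → a ∨ b ≡ true
∨-introˡ refl = refl

∨-introʳ : {a b : Bool} → b ≡ true → a ∨ b ≡ true
∨-introʳ {true}  _ = refl
∨-introʳ {false} e = e

∨-intro-false : {a b : Bool} → a ≡ false → b ≡ false → a ∨ b ≡ false
∨-intro-false refl refl = refl

∧-split : {a b : Bool} → a ∧ b ≡ true → a ≡ true × b ≡ true
∧-split {true} e = refl , e

∧-intro : {a b : Bool} → a ≡ true → b ≡ true → a ∧ b ≡ true
∧-intro refl refl = refl

Adj-sym : (G : Graph n) {i j : Fin n} → Adj G i j → Adj G j i
Adj-sym G {i} {j} e = trans (sym G j i) e

Adj-irrefl : (G : Graph n) {i j : Fin n} → i ≡ j → ¬ Adj G i j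
Adj-irrefl G {i} refl e = true≢false e (irrefl G i)

next-< : {a k : ℕ} → a < k → suc a % suc k ≡ suc a
next-< a<k = m<n⇒m%n≡m (s≤s a<k)

next-last : {a k : ℕ} → a ≡ k → suc a % suc k ≡ 0
next-last {k = k} refl = n%n≡0 (suc k)

-- Walks through a vertex set and their shortcuts

module _ (F : Graph n) (A : Fin n → Bool) where

  -- Only inner vertices must lie in `A`, and vertices may repeat. `at` is total on ℕ with its
  -- values beyond `l` ignored, so that splicing is plain index arithmetic.
  record Walk (y z : Fin n) (l : ℕ) : Set where
    field
      at     : ℕ → Fin n
      start  : at 0 ≡ y
      end    : at l ≡ z
      step   : ∀ i → i < l → Adj F (at i) (at (suc i))
      inside : ∀ i → suc i < l → A (at (suc i)) ≡ true
  open Walk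

  walk-edge : {y z : Fin n} → Adj F y z → Walk y z 1
  walk-edge {y} {z} e = record
    { at     = λ { zero → y ; (suc _) → z }
    ; start  = refl
    ; end    = refl
    ; step   = λ { zero _ → e ; (suc _) (s≤s ()) }
    ; inside = λ { _ (s≤s ()) }
    }

  walk-cons : {x y z : Fin n} {l : ℕ} → Adj F x y → A y ≡ true → Walk y z l → Walk x z (suc l)
  walk-cons {x} {y} {z} {l} e y∈A w = record
    { at     = at′
    ; start  = refl
    ; end    = end w
    ; step   = step′
    ; inside = inside′
    }
    where
    at′ : ℕ → Fin n
    at′ zero    = x
    at′ (suc i) = at w i
    step′ : ∀ i → i < suc l → Adj F (at′ i) (at′ (suc i))
    step′ zero    _ rewrite start w = e
    step′ (suc i) h = step w i (s≤s⁻¹ h)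
    inside′ : ∀ i → suc i < suc l → A (at′ (suc i)) ≡ true
    inside′ zero    _ rewrite start w = y∈A
    inside′ (suc i) h = inside w i (s≤s⁻¹ h)

  -- The edge jumps over the `g` vertices at positions `suc i` to `i + g`: positions up to `i` stay,
  -- later ones are shifted by `g`.
  walk-skip : {y z : Fin n} {l g i : ℕ} (w : Walk y z (l + g)) → i < l →
              Adj F (at w i) (at w (suc i + g)) → Walk y z l
  walk-skip {y} {z} {l} {g} {i} w i<l e = record
    { at     = at′
    ; start  = start w
    ; end    = end′
    ; step   = step′
    ; inside = inside′
    }
    where
    at′ : ℕ → Fin n
    at′ m with m ≤? i
    ... | yes _ = at w m
    ... | no  _ = at w (m + g)
    end′ : at′ l ≡ z
    end′ with l ≤? i
    ... | yes l≤i = contradiction i<l (≤⇒≯ l≤i)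
    ... | no  _   = end w
    step′ : ∀ m → m < l → Adj F (at′ m) (at′ (suc m))
    step′ m m<l with m ≤? i | suc m ≤? i
    ... | yes _   | yes _   = step w m (≤-trans m<l (m≤m+n l g))
    ... | yes m≤i | no m≮i with refl ← ≤-antisym m≤i (s≤s⁻¹ (≰⇒> m≮i)) = e
    ... | no m≰i  | yes m<i = contradiction (<⇒≤ m<i) m≰i
    ... | no _    | no _    = step w (m + g) (+-monoˡ-≤ g m<l)
    inside′ : ∀ m → suc m < l → A (at′ (suc m)) ≡ true
    inside′ m h with suc m ≤? i
    ... | yes _ = inside w m (≤-trans h (m≤m+n l g))
    ... | no  _ = inside w (m + g) (+-monoˡ-≤ g h)

  walk-shorten : {y z : Fin n} {l i j : ℕ} (w : Walk y z l) → suc i < j → j ≤ l →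
                 Adj F (at w i) (at w j) → ∃ λ l′ → l′ < l × Walk y z l′
  walk-shorten {i = i} w i<j j≤l e
    with g , refl ← m≤n⇒∃[o]m+o≡n i<j | d , refl ← m≤n⇒∃[o]m+o≡n j≤l =
    suc i + d , s≤s (+-monoˡ-≤ d (s≤s (m≤m+n i g))) , skip w (rearrange i g d) (≡-sym (+-suc (suc i) g)) e
    where
    rearrange : ∀ i g d → suc (suc i) + g + d ≡ suc i + d + suc g
    rearrange = solve-∀
    skip : ∀ {y z L j g d} (w : Walk y z L) → L ≡ suc i + d + g → j ≡ suc i + g →
           Adj F (at w i) (at w j) → Walk y z (suc i + d)
    skip {d = d} w refl refl e = walk-skip w (s≤s (m≤m+n i d)) e

  Step : Fin n → Fin n → Set
  Step a b = A a ≡ true × A b ≡ true × Adj F a b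

  star-walk : {y a b z : Fin n} → A a ≡ true → Adj F y a → Star Step a b → Adj F b z → ∃ (Walk y z)
  star-walk a∈A e ε e′ = _ , walk-cons e a∈A (walk-edge e′)
  star-walk a∈A e ((_ , b∈A , d) ◅ s) e′ =
    _ , walk-cons e a∈A (proj₂ (star-walk b∈A d s e′))

  -- Closing a walk from y to z inside A through r gives a cycle whose chord can only shorten the walk.
  module _ (chordal : Chordal F) {r y z : Fin n}
           (y≢z : y ≢ z) (y≁z : ¬ Adj F y z) (z∉A : A z ≡ false)
           (r∉A : A r ≡ false) (r≁A : ∀ a → A a ≡ true → ¬ Adj F r a)
           (r~y : Adj F r y) (r~z : Adj F r z) where

    shorten : {l : ℕ} → 2 ≤ l → Walk y z l → ∃ λ l′ → l′ < l × Walk y z l′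
    shorten {l} 2≤l w with any? (λ (i : Fin (suc l)) → any? (λ (j : Fin (suc l)) →
                              (toℕ i <? toℕ j) ×-dec (at w (toℕ i) ≟ at w (toℕ j))))
    ... | yes (i , j , i<j , same) with m≤n⇒m<n∨m≡n (s≤s⁻¹ (toℕ<n j))
    -- The step that leaves the second of two equal vertices also leaves the first, and so is a
    -- shortcut.
    ...   | inj₁ j<l = walk-shorten w (s≤s i<j) j<l
                         (subst (λ v → Adj F v (at w (suc (toℕ j)))) (≡-sym same) (step w _ j<l))
    -- The end `z` cannot occur earlier: position 0 is `y`, and inner positions lie in `A`.
    ...   | inj₂ j≡l = ⊥-elim (absurd (toℕ i) (subst (toℕ i <_) j≡l i<j)
                                 (trans same (trans (cong (at w) j≡l) (end w))))
      where
      absurd : ∀ i → i < l → at w i ≡ z → ⊥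
      absurd zero    _ e = y≢z (trans (≡-sym (start w)) e)
      absurd (suc i) h e = true≢false (inside w i h) (trans (cong A e) z∉A)
    -- The cycle is `r` followed by the `suc l` vertices of the walk. `Chordal` is indexed by the
    -- cycle length minus one, so `2 ≤ l` gives length at least 4. No chord ends at `r`: the only
    -- walk vertices adjacent to `r` are its neighbours on the cycle.
    shorten {l} 2≤l w | no distinct = from-chord (chordal (suc l) (s≤s 2≤l) c (c-inj , c-adj))
      where
      at-inj : ∀ i j → at w (toℕ {suc l} i) ≡ at w (toℕ {suc l} j) → i ≡ j
      at-inj i j e with <-cmp (toℕ i) (toℕ j)
      ... | tri< lt _ _ = contradiction (i , j , lt , e) distinct
      ... | tri≈ _ eq _ = toℕ-injective eq
      ... | tri> _ _ gt = contradiction (j , i , gt , ≡-sym e) distinct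

      place : ∀ i → i ≤ l → i ≡ 0 ⊎ i ≡ l ⊎ A (at w i) ≡ true
      place zero    _ = inj₁ refl
      place (suc i) h with m≤n⇒m<n∨m≡n h
      ... | inj₁ lt = inj₂ (inj₂ (inside w i lt))
      ... | inj₂ eq = inj₂ (inj₁ eq)

      r~first : Adj F r (at w 0)
      r~first rewrite start w = r~y
      r~last : Adj F r (at w l)
      r~last rewrite end w = r~z

      c : Fin (suc (suc l)) → Fin n
      c zero    = r
      c (suc a) = at w (toℕ a)

      r∉walk : ∀ (a : Fin (suc l)) → r ≢ at w (toℕ a)
      r∉walk a e with place (toℕ a) (s≤s⁻¹ (toℕ<n a))
      ... | inj₁ p = Adj-irrefl F (trans e (cong (at w) p)) r~first
      ... | inj₂ (inj₁ p) = Adj-irrefl F (trans e (cong (at w) p)) r~last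
      ... | inj₂ (inj₂ p) = true≢false p (trans (cong A (≡-sym e)) r∉A)

      c-inj : Injective _≡_ _≡_ c
      c-inj {zero}  {zero}  _ = refl
      c-inj {zero}  {suc b} e = contradiction e (r∉walk b)
      c-inj {suc a} {zero}  e = contradiction (≡-sym e) (r∉walk a)
      c-inj {suc a} {suc b} e = cong suc (at-inj a b e)

      c-next : ∀ a b → toℕ b ≡ suc (toℕ a) % suc (suc l) → Adj F (c a) (c b)
      c-next zero b e with b | trans e (next-< {0} {suc l} (s≤s z≤n))
      ... | suc b′ | q rewrite cong pred q = r~first
      c-next (suc a) b e with m≤n⇒m<n∨m≡n (s≤s⁻¹ (toℕ<n a))
      ... | inj₁ a<l with b | trans e (next-< (s≤s a<l))
      ...   | suc b′ | q rewrite cong pred q = step w (toℕ a) a<l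
      c-next (suc a) b e | inj₂ a≡l with b | trans e (next-last (cong suc a≡l))
      ...   | zero | _ rewrite a≡l = Adj-sym F r~last

      c-adj : ∀ a b → Consecutive (suc l) a b → Adj F (c a) (c b)
      c-adj a b (inj₁ e) = c-next a b e
      c-adj a b (inj₂ e) = Adj-sym F (c-next b a e)

      r-chord : ∀ (b : Fin (suc l)) → ¬ Consecutive (suc l) zero (suc b) → ¬ Adj F r (at w (toℕ b))
      r-chord b ¬con e with place (toℕ b) (s≤s⁻¹ (toℕ<n b))
      ... | inj₁ p = ¬con (inj₁ (trans (cong suc p) (≡-sym (next-< {0} {suc l} (s≤s z≤n)))))
      ... | inj₂ (inj₁ p) = ¬con (inj₂ (≡-sym (next-last (cong suc p))))
      ... | inj₂ (inj₂ p) = r≁A _ p e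

      w-chord : ∀ (a b : Fin (suc l)) → toℕ a < toℕ b → ¬ Consecutive (suc l) (suc a) (suc b) →
                Adj F (at w (toℕ a)) (at w (toℕ b)) → ∃ λ l′ → l′ < l × Walk y z l′
      w-chord a b a<b ¬con e with m≤n⇒m<n∨m≡n a<b
      ... | inj₁ lt = walk-shorten w lt (s≤s⁻¹ (toℕ<n b)) e
      ... | inj₂ eq = ⊥-elim (¬con (inj₁ (trans (cong suc (≡-sym eq))
                        (≡-sym (next-< (s≤s (<-≤-trans a<b (s≤s⁻¹ (toℕ<n b)))))))))

      from-chord : (Σ _ λ a → Σ _ λ b → a ≢ b × ¬ Consecutive (suc l) a b × Adj F (c a) (c b)) →
                   ∃ λ l′ → l′ < l × Walk y z l′
      from-chord (zero  , zero  , a≢b , _    , _) = contradiction refl a≢b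
      from-chord (zero  , suc b , _   , ¬con , e) = ⊥-elim (r-chord b ¬con e)
      from-chord (suc a , zero  , _   , ¬con , e) = ⊥-elim (r-chord a (¬con ∘ swap) (Adj-sym F e))
      from-chord (suc a , suc b , a≢b , ¬con , e) with <-cmp (toℕ a) (toℕ b)
      ... | tri< lt _ _ = w-chord a b lt ¬con e
      ... | tri≈ _ eq _ = contradiction (cong suc (toℕ-injective eq)) a≢b
      ... | tri> _ _ gt = w-chord b a gt (¬con ∘ swap) (Adj-sym F e)

    -- Descent on the length, with `N` as fuel: `y≢z` and `y≁z` rule out lengths 0 and 1, and from 2
    -- on `shorten` applies.
    no-walk : (N : ℕ) {l : ℕ} → l ≤ N → ¬ Walk y z l
    no-walk N {zero} _ w = y≢z (trans (≡-sym (start w)) (end w))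
    no-walk N {suc zero} _ w = y≁z (subst₂ (Adj F) (start w) (end w) (step w 0 ≤-refl))
    no-walk (suc N) {suc (suc l)} h w with l′ , lt , w′ ← shorten (s≤s (s≤s z≤n)) w =
      no-walk N (s≤s⁻¹ (≤-trans lt h)) w′

-- Maximal connected sets with a vertex out of reach

module _ (F : Graph n) where

  Nbr : (A : Fin n → Bool) → Fin n → Set
  Nbr A v = ∃ λ a → A a ≡ true × Adj F a v

  Far : (A : Fin n → Bool) → Fin n → Set
  Far A v = A v ≡ false × ¬ Nbr A v

  far? : (A : Fin n → Bool) (v : Fin n) → Dec (Far A v)
  far? A v = (A v Bool.≟ false) ×-dec ¬? (any? λ a → (A a Bool.≟ true) ×-dec (adj F a v Bool.≟ true))

  -- Inside `W`, the neighbours of `A` separate the connected set `A` from `far`.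
  record Separator (W A : Fin n → Bool) : Set where
    field
      root      : Fin n
      root∈A    : A root ≡ true
      A⊆W       : ∀ i → A i ≡ true → W i ≡ true
      connected : ∀ {a b} → A a ≡ true → A b ≡ true → Star (Step F A) a b
      far       : Fin n
      far∈W     : W far ≡ true
      far-far   : Far A far
  open Separator

  -- The local form of maximality: a pair `y`, `r` violating it would let `grow` add `y` to `A`.
  Saturated : (W A : Fin n → Bool) → Set
  Saturated W A = ∀ y r → W y ≡ true → A y ≡ false → Nbr A y → W r ≡ true → Far A r → Adj F y r

  -- `y` hangs on `A` through `a₀`, which keeps the set connected. The old far vertex may be a
  -- neighbour of `y`, so `r` takes over its role.
  grow : {W A : Fin n → Bool} → Separator W A → (y r : Fin n) → W y ≡ true → Nbr A y →
         W r ≡ true → Far A r → adj F y r ≡ false → Separator W (λ i → A i ∨ is y i)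
  grow {W} {A} S y r y∈W (a₀ , a₀∈A , a₀~y) r∈W (r∉A , r≁A) y≁r = record
    { root      = root S
    ; root∈A    = ∨-introˡ (root∈A S)
    ; A⊆W       = λ i e → A⊆W′ i (∨-split {A i} e)
    ; connected = λ {a} {b} p q → conn (∨-split {A a} p) (∨-split {A b} q)
    ; far       = r
    ; far∈W     = r∈W
    ; far-far   = ∨-intro-false r∉A (≢true⇒false (r≢y ∘ is⇒≡ y r)) , far′
    }
    where
    A′ : Fin n → Bool
    A′ i = A i ∨ is y i
    y∈A′ : A′ y ≡ true
    y∈A′ = ∨-introʳ {A y} (is-refl y)
    r≢y : r ≢ y
    r≢y refl = r≁A (a₀ , a₀∈A , a₀~y)
    A⊆W′ : ∀ i → A i ≡ true ⊎ is y i ≡ true → W i ≡ true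
    A⊆W′ i (inj₁ p) = A⊆W S i p
    A⊆W′ i (inj₂ p) rewrite is⇒≡ y i p = y∈W
    lift : ∀ {a b} → Star (Step F A) a b → Star (Step F A′) a b
    lift = Star.map λ (p , q , e) → ∨-introˡ p , ∨-introˡ q , e
    conn : ∀ {a b} → A a ≡ true ⊎ is y a ≡ true → A b ≡ true ⊎ is y b ≡ true → Star (Step F A′) a b
    conn (inj₁ p) (inj₁ q) = lift (connected S p q)
    conn {b = b} (inj₁ p) (inj₂ q) rewrite is⇒≡ y b q =
      lift (connected S p a₀∈A) ◅◅ ((∨-introˡ a₀∈A , y∈A′ , a₀~y) ◅ ε)
    conn {a} (inj₂ p) (inj₁ q) rewrite is⇒≡ y a p =
      (y∈A′ , ∨-introˡ a₀∈A , Adj-sym F a₀~y) ◅ lift (connected S a₀∈A q)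
    conn {a} {b} (inj₂ p) (inj₂ q) rewrite is⇒≡ y a p | is⇒≡ y b q = ε
    far′ : ¬ Nbr A′ r
    far′ (a , a∈A′ , e) with ∨-split {A a} a∈A′
    ... | inj₁ p = r≁A (a , p , e)
    ... | inj₂ p rewrite is⇒≡ y a p = true≢false e y≁r

  -- Each growth adds a vertex, so `M` bounds the growths still possible. At `M = 0` the set would
  -- contain every vertex, but `far` lies outside it.
  saturate : (M : ℕ) {W A : Fin n → Bool} → n ≤ M + card A → Separator W A →
             Σ (Fin n → Bool) λ B → Separator W B × Saturated W B
  saturate zero {A = A} h S =
    contradiction h (<⇒≱ (subst (card A <_) card-full
      (card-mono-< {P = A} (λ _ _ → refl) (far S) (proj₁ (far-far S)) refl)))
  saturate (suc M) {W} {A} h S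
    with any? (λ y → any? (λ r → (W y Bool.≟ true) ×-dec (A y Bool.≟ false) ×-dec
           any? (λ a → (A a Bool.≟ true) ×-dec (adj F a y Bool.≟ true)) ×-dec
           (W r Bool.≟ true) ×-dec far? A r ×-dec (adj F y r Bool.≟ false)))
  ... | yes (y , r , y∈W , y∉A , nb , r∈W , fr , y≁r) =
    saturate M (≤-trans h (≤-trans (≤-reflexive (≡-sym (+-suc M (card A))))
        (+-monoʳ-≤ M (card-mono-< {P = A} (λ _ → ∨-introˡ) y y∉A (∨-introʳ {A y} (is-refl y))))))
      (grow S y r y∈W nb r∈W fr y≁r)
  ... | no none = A , S , λ y r y∈W y∉A nb r∈W fr →
    ≢false⇒true λ e → none (y , r , y∈W , y∉A , nb , r∈W , fr , e)

  Simplicial : (W : Fin n → Bool) → Fin n → Set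
  Simplicial W v = ∀ x y → W x ≡ true → W y ≡ true → Adj F v x → Adj F v y → x ≢ y → Adj F x y

  Beyond : (W A : Fin n → Bool) → Fin n → Bool
  Beyond W A i = W i ∧ does (far? A i)

  Beyond-intro : (W A : Fin n → Bool) {i : Fin n} → W i ≡ true → Far A i → Beyond W A i ≡ true
  Beyond-intro W A {i} i∈W fi = ∧-intro i∈W (dec-true (far? A i) fi)

  Beyond-elim : (W A : Fin n → Bool) {i : Fin n} → Beyond W A i ≡ true → W i ≡ true × Far A i
  Beyond-elim W A {i} e with i∈W , q ← ∧-split {W i} e = i∈W , does-true (far? A i) q

  singleton-separator : {W : Fin n → Bool} (x r : Fin n) → W x ≡ true → W r ≡ true →
                        x ≢ r → adj F x r ≡ false → Separator W (is x)
  singleton-separator {W} x r x∈W r∈W x≢r x≁r = record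
    { root      = x
    ; root∈A    = is-refl x
    ; A⊆W       = λ i e → subst (λ v → W v ≡ true) (≡-sym (is⇒≡ x i e)) x∈W
    ; connected = λ {a} {b} p q → conn (is⇒≡ x a p) (is⇒≡ x b q)
    ; far       = r
    ; far∈W     = r∈W
    ; far-far   = ≢true⇒false (x≢r ∘ ≡-sym ∘ is⇒≡ x r)
                , λ (a , p , e) → true≢false (subst (λ v → Adj F v r) (is⇒≡ x a p) e) x≁r
    }
    where
    conn : ∀ {a b} → a ≡ x → b ≡ x → Star (Step F (is x)) a b
    conn refl refl = ε

  -- A neighbour of `v` is not in `A`, so it is either far or adjacent to `A`. Two far ones fall
  -- under `simp`, a mixed pair under saturation. Two that are adjacent to `A` are joined by a walk
  -- through `A`, while `v` has no contact with `A` and is adjacent to both; if they were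
  -- non-adjacent, `no-walk` would forbid this walk.
  simplicial-extend : Chordal F → {W A : Fin n → Bool} → Separator W A → Saturated W A → {v : Fin n} →
                      Far A v → Simplicial (Beyond W A) v → Simplicial W v
  simplicial-extend chordal {W} {A} S sat {v} (v∉A , v≁A) simp x y x∈W y∈W v~x v~y x≢y = case (far? A x) (far? A y)
    where
    outside : ∀ {u} → Adj F v u → A u ≡ false
    outside {u} e = ≢true⇒false λ u∈A → v≁A (u , u∈A , Adj-sym F e)
    nbr : ∀ {u} → Adj F v u → ¬ Far A u → Nbr A u
    nbr {u} e ¬far with any? (λ a → (A a Bool.≟ true) ×-dec (adj F a u Bool.≟ true))
    ... | yes p = p
    ... | no ¬p = contradiction (outside e , ¬p) ¬far
    linked : Nbr A x → Nbr A y → ¬ adj F x y ≡ false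
    linked (a , a∈A , a~x) (b , b∈A , b~y) x≁y =
      no-walk F A chordal x≢y (λ e → true≢false e x≁y) (outside v~y) v∉A
        (λ c c∈A e → v≁A (c , c∈A , Adj-sym F e)) v~x v~y _ ≤-refl
        (proj₂ (star-walk F A a∈A (Adj-sym F a~x) (connected S a∈A b∈A) b~y))
    case : Dec (Far A x) → Dec (Far A y) → Adj F x y
    case (yes fx) (yes fy) = simp x y (Beyond-intro W A x∈W fx) (Beyond-intro W A y∈W fy) v~x v~y x≢y
    case (yes fx) (no ¬fy) = Adj-sym F (sat y x y∈W (outside v~y) (nbr v~y ¬fy) x∈W fx)
    case (no ¬fx) (yes fy) = sat x y x∈W (outside v~x) (nbr v~x ¬fx) y∈W fy
    case (no ¬fx) (no ¬fy) = ≢false⇒true (linked (nbr v~x ¬fx) (nbr v~y ¬fy))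

  -- Dirac's theorem. For a maximal connected A with W ∖ N[A] nonempty, every neighbour of A is joined
  -- to all of W ∖ N[A], so a simplicial vertex of W ∖ N[A] stays simplicial in W.
  simplicial-vertex : Chordal F → (N : ℕ) (W : Fin n → Bool) → card W ≤ N → (∃ λ w → W w ≡ true) →
                      ∃ λ v → W v ≡ true × Simplicial W v
  simplicial-vertex chordal zero W h (w , w∈W) =
    contradiction h (<⇒≱ (≤-<-trans z≤n (card-mono-< {P = λ _ → false} {W} (λ _ ()) w refl w∈W)))
  simplicial-vertex chordal (suc N) W h (w , w∈W)
    with any? (λ x → any? (λ r → (W x Bool.≟ true) ×-dec (W r Bool.≟ true) ×-dec
           ¬? (x ≟ r) ×-dec (adj F x r Bool.≟ false)))
  ... | no none =
    w , w∈W , λ x y x∈W y∈W _ _ x≢y → ≢false⇒true λ e → none (x , y , x∈W , y∈W , x≢y , e)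
  ... | yes (x , r , x∈W , r∈W , x≢r , x≁r)
    with A , S , sat ← saturate n (m≤m+n n _) (singleton-separator x r x∈W r∈W x≢r x≁r)
    -- The recursion is on a smaller set, since `root` lies in `W` but not beyond `A`.
    with v , v∈R , simp ← simplicial-vertex chordal N (Beyond W A)
           (s≤s⁻¹ (≤-trans (card-mono-< {P = Beyond W A} (λ i → proj₁ ∘ Beyond-elim W A) (root S)
              (≢true⇒false λ e → true≢false (root∈A S) (proj₁ (proj₂ (Beyond-elim W A e))))
              (A⊆W S _ (root∈A S))) h))
           (far S , Beyond-intro W A (far∈W S) (far-far S))
    with v∈W , fv ← Beyond-elim W A v∈R
    = v , v∈W , simplicial-extend chordal S sat fv simp

-- The number of edges of a chordal graph

weight : (Fin n → Bool) → (Fin n → ℕ) → ℕ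
weight P g = sum λ i → ⟦ P i ⟧ * g i

weight-≥ : {P : Fin n → Bool} {g : Fin n → ℕ} {a : ℕ} → (∀ i → P i ≡ true → a ≤ g i) → card P * a ≤ weight P g
weight-≥ {P = P} {g} {a} h = ≤-trans (≤-reflexive (*-distribʳ-sum a (λ i → ⟦ P i ⟧))) (sum-mono-≤ term)
  where
  term : ∀ i → ⟦ P i ⟧ * a ≤ ⟦ P i ⟧ * g i
  term i with P i in eq
  ... | true  = *-monoʳ-≤ 1 (h i eq)
  ... | false = z≤n

weight-≤ : {P : Fin n → Bool} {g : Fin n → ℕ} {a : ℕ} → (∀ i → P i ≡ true → g i ≤ a) → weight P g ≤ card P * a
weight-≤ {P = P} {g} {a} h = ≤-trans (sum-mono-≤ term) (≤-reflexive (≡-sym (*-distribʳ-sum a (λ i → ⟦ P i ⟧))))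
  where
  term : ∀ i → ⟦ P i ⟧ * g i ≤ ⟦ P i ⟧ * a
  term i with P i in eq
  ... | true  = *-monoʳ-≤ 1 (h i eq)
  ... | false = z≤n

sum-distrib² : (f g : Fin n → Fin n → ℕ) →
               sum (λ i → sum λ j → f i j + g i j) ≡ sum (λ i → sum (f i)) + sum (λ i → sum (g i))
sum-distrib² f g = trans (sum-cong-≗ λ i → ∑-distrib-+ (f i) (g i)) (∑-distrib-+ (λ i → sum (f i)) (λ i → sum (g i)))

sum-mono² : {f g : Fin n → Fin n → ℕ} → (∀ i j → f i j ≤ g i j) →
            sum (λ i → sum (f i)) ≤ sum (λ i → sum (g i))
sum-mono² h = sum-mono-≤ λ i → sum-mono-≤ (h i)

degIn : Graph n → (Fin n → Bool) → Fin n → ℕ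
degIn F W v = card λ j → W j ∧ adj F v j

total : Graph n → (Fin n → Bool) → ℕ
total F W = sum λ i → sum λ j → ⟦ W i ∧ (W j ∧ adj F i j) ⟧

_∖_ : (Fin n → Bool) → Fin n → Fin n → Bool
(W ∖ v) i = W i ∧ not (is v i)

card-∖ : (W : Fin n → Bool) (v : Fin n) → W v ≡ true → card W ≡ suc (card (W ∖ v))
card-∖ W v v∈W = begin
  card W ≡⟨ sum-cong-≗ (λ i → split (W i) (is v i)) ⟩
  sum (λ i → ⟦ is v i ⟧ * ⟦ W i ⟧ + ⟦ (W ∖ v) i ⟧) ≡⟨ ∑-distrib-+ (λ i → ⟦ is v i ⟧ * ⟦ W i ⟧) _ ⟩
  sum (λ i → ⟦ is v i ⟧ * ⟦ W i ⟧) + card (W ∖ v) ≡⟨ cong (_+ card (W ∖ v)) (sum-is v (λ i → ⟦ W i ⟧)) ⟩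
  ⟦ W v ⟧ + card (W ∖ v) ≡⟨ cong (λ b → ⟦ b ⟧ + card (W ∖ v)) v∈W ⟩
  suc (card (W ∖ v)) ∎
  where
  open ≡-Reasoning
  split : ∀ a p → ⟦ a ⟧ ≡ ⟦ p ⟧ * ⟦ a ⟧ + ⟦ a ∧ not p ⟧
  split true  true  = refl
  split true  false = refl
  split false true  = refl
  split false false = refl

total-∖ : (F : Graph n) (W : Fin n → Bool) (v : Fin n) →
          total F W ≤ total F (W ∖ v) + (degIn F W v + degIn F W v)
total-∖ F W v = begin
  total F W
    ≤⟨ sum-mono² (λ i j → peel (W i) (W j) (adj F i j) (is v i) (is v j)) ⟩
  sum (λ i → sum λ j → f i j + (g i j + h i j))
    ≡⟨ sum-distrib² f (λ i j → g i j + h i j) ⟩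
  total F (W ∖ v) + sum (λ i → sum λ j → g i j + h i j)
    ≡⟨ cong (total F (W ∖ v) +_) (sum-distrib² g h) ⟩
  total F (W ∖ v) + (sum (λ i → sum (g i)) + sum (λ i → sum (h i)))
    ≡⟨ cong (total F (W ∖ v) +_) (cong₂ _+_ (sum-is² v λ i j → ⟦ W j ∧ adj F i j ⟧) column) ⟩
  total F (W ∖ v) + (degIn F W v + degIn F W v) ∎
  where
  open ≤-Reasoning
  f g h : Fin _ → Fin _ → ℕ
  f i j = ⟦ (W ∖ v) i ∧ ((W ∖ v) j ∧ adj F i j) ⟧
  g i j = ⟦ is v i ⟧ * ⟦ W j ∧ adj F i j ⟧
  h i j = ⟦ is v j ⟧ * ⟦ W i ∧ adj F i j ⟧
  column : sum (λ i → sum (h i)) ≡ degIn F W v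
  column = trans (∑-comm h) (trans (sum-is² v λ j i → ⟦ W i ∧ adj F i j ⟧)
             (sum-cong-≗ λ i → cong (λ e → ⟦ W i ∧ e ⟧) (sym F i v)))
  peel : ∀ a b e p q → ⟦ a ∧ (b ∧ e) ⟧ ≤
         ⟦ (a ∧ not p) ∧ ((b ∧ not q) ∧ e) ⟧ + (⟦ p ⟧ * ⟦ b ∧ e ⟧ + ⟦ q ⟧ * ⟦ a ∧ e ⟧)
  peel false _     _     _     _     = z≤n
  peel true  false _     _     _     = z≤n
  peel true  true  false _     _     = z≤n
  peel true  true  true  true  _     = s≤s z≤n
  peel true  true  true  false true  = s≤s z≤n
  peel true  true  true  false false = s≤s z≤n

card-zero : (W : Fin n → Bool) → card W ≡ 0 → ∀ i → W i ≡ false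
card-zero W e i = ≢true⇒false λ i∈W →
  contradiction e (>⇒≢ (≤-<-trans z≤n (card-mono-< {P = λ _ → false} {W} (λ _ ()) i refl i∈W)))

clique-cons : (F : Graph n) {k : ℕ} (v : Fin n) (f : Fin k → Fin n) → Injective _≡_ _≡_ f →
              (∀ a b → a ≢ b → Adj F (f a) (f b)) → (∀ a → Adj F v (f a)) → HasClique (suc k) F
clique-cons {n} F {k} v f inj f~f v~f = g , g-inj , g~g
  where
  g : Fin (suc k) → Fin n
  g zero    = v
  g (suc i) = f i
  g-inj : Injective _≡_ _≡_ g
  g-inj {zero}  {zero}  _ = refl
  g-inj {zero}  {suc j} e = contradiction (v~f j) (Adj-irrefl F e)
  g-inj {suc i} {zero}  e = contradiction (v~f i) (Adj-irrefl F (≡-sym e))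
  g-inj {suc i} {suc j} e = cong suc (inj e)
  g~g : ∀ a b → a ≢ b → Adj F (g a) (g b)
  g~g zero    zero    a≢b = contradiction refl a≢b
  g~g zero    (suc j) _   = v~f j
  g~g (suc i) zero    _   = Adj-sym F (v~f i)
  g~g (suc i) (suc j) a≢b = f~f i j (a≢b ∘ cong suc)

-- The number of edges of a μ-tree on w vertices.
cap : ℕ → ℕ → ℕ
cap μ zero    = 0
cap μ (suc w) = cap μ w + w ⊓ μ

-- Remove a simplicial vertex `v` of `W`. Its neighbours in `W` form a clique: more than `μ` of them
-- yield, together with `v`, a clique on `μ + 2` vertices. Otherwise the removal costs at most
-- `N ⊓ μ` edges, which is the increment of `cap`.
chordal-total : (F : Graph n) → Chordal F → (μ N : ℕ) (W : Fin n → Bool) → card W ≡ N →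
                HasClique (suc (suc μ)) F ⊎ total F W ≤ cap μ N + cap μ N
chordal-total {n} F ch μ zero W e = inj₂ (≤-reflexive
  (trans (sum-cong-≗ λ i → trans (sum-cong-≗ λ j → cong (λ b → ⟦ b ∧ (W j ∧ adj F i j) ⟧) (card-zero W e i)) (sum-zero {n}))
         (sum-zero {n})))
chordal-total {n} F ch μ (suc N) W e
  with v , v∈W , simp ← simplicial-vertex F ch (suc N) W (≤-reflexive e)
                          (card-nonempty W (subst (0 <_) (≡-sym e) (s≤s z≤n)))
  with degIn F W v ≤? μ
... | no d≰μ
  with f , inj , f∈ ← card-pick (λ j → W j ∧ adj F v j) (suc μ) (≰⇒> d≰μ) =
  inj₁ (clique-cons F v f inj (λ a b a≢b →
    simp (f a) (f b) (proj₁ (∧-split {W (f a)} (f∈ a))) (proj₁ (∧-split {W (f b)} (f∈ b)))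
      (proj₂ (∧-split {W (f a)} (f∈ a))) (proj₂ (∧-split {W (f b)} (f∈ b))) (a≢b ∘ inj))
    (λ a → proj₂ (∧-split {W (f a)} (f∈ a))))
... | yes d≤μ with chordal-total F ch μ N (W ∖ v) (cong pred (trans (≡-sym (card-∖ W v v∈W)) e))
...   | inj₁ clique = inj₁ clique
...   | inj₂ ih = inj₂ (≤-trans (total-∖ F W v)
                   (≤-trans (+-mono-≤ ih (+-mono-≤ d≤ d≤)) (≤-reflexive (regroup (cap μ N) (N ⊓ μ)))))
  where
  regroup : ∀ c d → c + c + (d + d) ≡ c + d + (c + d)
  regroup = solve-∀
  inW∖v : ∀ j → W j ∧ adj F v j ≡ true → (W ∖ v) j ≡ true
  inW∖v j p with j∈W , v~j ← ∧-split {W j} p =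
    ∧-intro j∈W (cong not (≢true⇒false λ q → Adj-irrefl F (≡-sym (is⇒≡ v j q)) v~j))
  d≤ : degIn F W v ≤ N ⊓ μ
  d≤ = ⊓-glb (≤-trans (card-mono inW∖v) (≤-reflexive (cong pred (trans (≡-sym (card-∖ W v v∈W)) e)))) d≤μ

chordal-edges : (F : Graph n) → Chordal F → (μ : ℕ) →
                HasClique (suc (suc μ)) F ⊎ sum (deg F) ≤ cap μ n + cap μ n
chordal-edges {n} F ch μ = chordal-total F ch μ n (λ _ → true) card-full

-- Up to `suc μ` vertices a `μ`-tree is complete, which `small` expresses without subtraction. Each
-- further vertex adds at most `μ` edges, while the right side grows by `μ + μ`.
cap-bound : (μ n : ℕ) → suc μ ≤ n → cap μ n + cap μ n + suc μ * μ ≤ μ * n + μ * n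
cap-bound μ n h with j , refl ← m≤n⇒∃[o]m+o≡n h = go j
  where
  small : ∀ w → w ≤ suc μ → cap μ w + cap μ w + w ≡ w * w
  small zero    _ = refl
  small (suc w) h rewrite m≤n⇒m⊓n≡m (s≤s⁻¹ h) =
    trans (regroup (cap μ w) w) (trans (cong (_+ (w + w + 1)) (small w (<⇒≤ h))) (square w))
    where
    regroup : ∀ c w → c + w + (c + w) + suc w ≡ c + c + w + (w + w + 1)
    regroup = solve-∀
    square : ∀ w → w * w + (w + w + 1) ≡ suc w * suc w
    square = solve-∀
  go : ∀ j → cap μ (suc μ + j) + cap μ (suc μ + j) + suc μ * μ ≤ μ * (suc μ + j) + μ * (suc μ + j)
  go zero rewrite +-identityʳ μ = ≤-reflexive (+-cancelʳ-≡ (suc μ) _ _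
    (trans (regroup (cap μ (suc μ)) μ) (trans (cong (_+ suc μ * μ) (small (suc μ) ≤-refl)) (square μ))))
    where
    regroup : ∀ c μ → c + c + suc μ * μ + suc μ ≡ c + c + suc μ + suc μ * μ
    regroup = solve-∀
    square : ∀ μ → suc μ * suc μ + suc μ * μ ≡ μ * suc μ + μ * suc μ + suc μ
    square = solve-∀
  go (suc j) rewrite +-suc μ j = begin
    c + d + (c + d) + suc μ * μ          ≡⟨ regroup c d (suc μ * μ) ⟩
    c + c + suc μ * μ + (d + d)          ≤⟨ +-mono-≤ (go j) (+-mono-≤ d≤μ d≤μ) ⟩
    μ * m + μ * m + (μ + μ)              ≡⟨ expand μ m ⟩
    μ * suc m + μ * suc m                ∎
    where
    open ≤-Reasoning
    m = suc (μ + j)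
    c = cap μ m
    d = m ⊓ μ
    d≤μ : d ≤ μ
    d≤μ = m⊓n≤n m μ
    regroup : ∀ c d x → c + d + (c + d) + x ≡ c + c + x + (d + d)
    regroup = solve-∀
    expand : ∀ μ m → μ * m + μ * m + (μ + μ) ≡ μ * suc m + μ * suc m
    expand = solve-∀

-- The edges that meet a clique

module _ (G : Graph n) (K : Fin n → Bool) where

  cone : Graph n
  cone = record
    { adj    = λ i j → adj G i j ∧ (K i ∨ K j)
    ; sym    = λ i j → cong₂ _∧_ (sym G i j) (Bool.∨-comm (K i) (K j))
    ; irrefl = λ i → cong (_∧ (K i ∨ K i)) (irrefl G i)
    }

  cone-⊆ : Subgraph cone G
  cone-⊆ i j e = proj₁ (∧-split {adj G i j} e)

  IsClique : Set
  IsClique = ∀ i j → K i ≡ true → K j ≡ true → i ≢ j → Adj G i j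

  -- Every edge of `cone` meets `K`, so of two consecutive cycle vertices at least one is in `K`.
  -- Among the first four vertices and the last, this forces two non-consecutive ones into `K`, and
  -- these are adjacent because `K` is a clique.
  cone-chordal : IsClique → Chordal cone
  cone-chordal clique (suc (suc (suc m))) (s≤s (s≤s (s≤s _))) c (inj , c-adj) = pick (∨-split {K (c 0F)} (touch 0F 1F (inj₁ refl)))
    where
    k = suc (suc (suc m))
    last : Fin (suc k)
    last = fromℕ k
    Chord : Set
    Chord = Σ _ λ a → Σ _ λ b → a ≢ b × ¬ Consecutive k a b × Adj cone (c a) (c b)
    touch : ∀ a b → Consecutive k a b → K (c a) ∨ K (c b) ≡ true
    touch a b con = proj₂ (∧-split {adj G (c a) (c b)} (c-adj a b con))
    chord : ∀ a b → a ≢ b → ¬ Consecutive k a b → K (c a) ≡ true → K (c b) ≡ true → Chord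
    chord a b a≢b ¬con p q = a , b , a≢b , ¬con , ∧-intro (clique _ _ p q (a≢b ∘ inj)) (∨-introˡ p)
    ¬02 : ¬ Consecutive k 0F 2F
    ¬02 (inj₁ ())
    ¬02 (inj₂ ())
    ¬13 : ∀ m → ¬ Consecutive (suc (suc (suc m))) 1F 3F
    ¬13 m       (inj₁ ())
    ¬13 zero    (inj₂ ())
    ¬13 (suc m) (inj₂ ())
    ¬1last : ¬ Consecutive k 1F last
    ¬1last (inj₁ e) with () ← trans (≡-sym (toℕ-fromℕ k)) e
    ¬1last (inj₂ e) with () ← trans e (next-last (toℕ-fromℕ k))
    from0 : K (c 0F) ≡ true → Chord
    from0 p with ∨-split {K (c 2F)} (touch 2F 1F (inj₂ refl)) | ∨-split {K (c 2F)} (touch 2F 3F (inj₁ refl))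
    ... | inj₁ q | _      = chord 0F 2F (λ ()) ¬02 p q
    ... | inj₂ q | inj₁ r = chord 0F 2F (λ ()) ¬02 p r
    ... | inj₂ q | inj₂ r = chord 1F 3F (λ ()) (¬13 m) q r
    pick : K (c 0F) ≡ true ⊎ K (c 1F) ≡ true → Chord
    pick (inj₁ p) = from0 p
    pick (inj₂ q) with ∨-split {K (c last)} (touch last 0F (inj₁ (≡-sym (next-last (toℕ-fromℕ k)))))
    ... | inj₁ r = chord 1F last (λ ()) ¬1last q r
    ... | inj₂ p = from0 p

  -- Summing degrees over `K` counts an edge once for each end in `K`, so only edges inside `K` are
  -- counted twice. The term `h` collects these, at most `pred (card K)` at each vertex of `K`.
  cone-edges : weight K (deg G) + weight K (deg G) ≤ sum (deg cone) + card K * pred (card K)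
  cone-edges = begin
    weight K (deg G) + weight K (deg G)                    ≡⟨ cong₂ _+_ rows columns ⟩
    sum (λ i → sum (f i)) + sum (λ i → sum λ j → g i j)    ≡⟨ sum-distrib² f g ⟨
    sum (λ i → sum λ j → f i j + g i j)                    ≤⟨ sum-mono² (λ i j → count (K i) (K j) (adj G i j)) ⟩
    sum (λ i → sum λ j → ⟦ adj cone i j ⟧ + h i j)         ≡⟨ sum-distrib² (λ i j → ⟦ adj cone i j ⟧) h ⟩
    sum (deg cone) + sum (λ i → sum (h i))                 ≡⟨ cong (sum (deg cone) +_) inner-rows ⟩
    sum (deg cone) + weight K (degIn G K)                  ≤⟨ +-monoʳ-≤ (sum (deg cone)) (weight-≤ inner) ⟩
    sum (deg cone) + card K * pred (card K)                ∎
    where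
    open ≤-Reasoning
    f g h : Fin n → Fin n → ℕ
    f i j = ⟦ K i ⟧ * ⟦ adj G i j ⟧
    g i j = ⟦ K j ⟧ * ⟦ adj G i j ⟧
    h i j = ⟦ K i ⟧ * ⟦ K j ∧ adj G i j ⟧
    rows : weight K (deg G) ≡ sum (λ i → sum (f i))
    rows = sum-cong-≗ λ i → *-distribˡ-sum ⟦ K i ⟧ λ j → ⟦ adj G i j ⟧
    columns : weight K (deg G) ≡ sum (λ i → sum λ j → g i j)
    columns = trans rows (trans (sum-cong-≗ λ i → sum-cong-≗ λ j → cong (λ e → ⟦ K i ⟧ * ⟦ e ⟧) (sym G i j))
                (∑-comm λ i j → g j i))
    count : ∀ a b e → ⟦ a ⟧ * ⟦ e ⟧ + ⟦ b ⟧ * ⟦ e ⟧ ≤ ⟦ e ∧ (a ∨ b) ⟧ + ⟦ a ⟧ * ⟦ b ∧ e ⟧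
    count false false true  = z≤n
    count false true  true  = ≤-refl
    count true  false true  = ≤-refl
    count true  true  true  = ≤-refl
    count false false false = z≤n
    count false true  false = z≤n
    count true  false false = z≤n
    count true  true  false = z≤n
    inner-rows : sum (λ i → sum (h i)) ≡ weight K (degIn G K)
    inner-rows = sum-cong-≗ λ i → ≡-sym (*-distribˡ-sum ⟦ K i ⟧ λ j → ⟦ K j ∧ adj G i j ⟧)
    inner : ∀ i → K i ≡ true → degIn G K i ≤ pred (card K)
    inner i i∈K = <⇒≤pred (card-mono-< {P = λ j → K j ∧ adj G i j} (λ j → proj₁ ∘ ∧-split {K j}) i
                    (≢true⇒false λ e → Adj-irrefl G refl (proj₂ (∧-split {K i} e))) i∈K)

-- The greedy clique

-- The codegree sum of the complete multipartite graph with parts of these sizes, as `same-total`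
-- shows: each of the `a` vertices of a part has codegree `a`.
sumSq : List ℕ → ℕ
sumSq []       = 0
sumSq (a ∷ as) = a * a + sumSq as

colour : (as : List ℕ) → Fin (List.sum as) → Fin (length as)
colour (a ∷ as) i = [ const zero , suc ∘ colour as ]′ (splitAt a i)

sum-splitAt : (a : ℕ) {m : ℕ} (f : Fin (a + m) → ℕ) → sum f ≡ sum (λ i → f (i ↑ˡ m)) + sum (λ i → f (a ↑ʳ i))
sum-splitAt zero    f = refl
sum-splitAt (suc a) f = trans (cong (f zero +_) (sum-splitAt a (f ∘ suc))) (≡-sym (+-assoc (f zero) _ _))

same : (as : List ℕ) → Fin (List.sum as) → Fin (List.sum as) → Bool
same as i j = does (colour as i ≟ colour as j)

same-total : (as : List ℕ) → sum (λ i → card (same as i)) ≡ sumSq as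
same-total [] = refl
same-total (a ∷ as) = trans (sum-splitAt a (λ i → card (same (a ∷ as) i))) (cong₂ _+_ head tail)
  where
  open ≡-Reasoning
  m = List.sum as
  left : ∀ i → colour (a ∷ as) (i ↑ˡ m) ≡ zero
  left i = cong [ const zero , suc ∘ colour as ]′ (splitAt-↑ˡ a i m)
  right : ∀ i → colour (a ∷ as) (a ↑ʳ i) ≡ suc (colour as i)
  right i = cong [ const zero , suc ∘ colour as ]′ (splitAt-↑ʳ a m i)
  rows : ∀ {p} i → colour (a ∷ as) i ≡ p → card (same (a ∷ as) i) ≡
         a * ⟦ does (p ≟ zero) ⟧ + sum (λ j → ⟦ does (p ≟ suc (colour as j)) ⟧)
  rows i refl = trans (sum-splitAt a λ j → ⟦ same (a ∷ as) i j ⟧) (cong₂ _+_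
    (trans (sum-cong-≗ λ j → cong (λ q → ⟦ does (colour (a ∷ as) i ≟ q) ⟧) (left j)) (sum-const {a} _))
    (sum-cong-≗ λ j → cong (λ q → ⟦ does (colour (a ∷ as) i ≟ q) ⟧) (right j)))
  head : sum (λ i → card (same (a ∷ as) (i ↑ˡ m))) ≡ a * a
  head = begin
    sum (λ i → card (same (a ∷ as) (i ↑ˡ m))) ≡⟨ sum-cong-≗ (λ i → rows (i ↑ˡ m) (left i)) ⟩
    sum {a} (λ _ → a * 1 + sum {m} (λ _ → 0)) ≡⟨ sum-const {a} _ ⟩
    a * (a * 1 + sum {m} (λ _ → 0))           ≡⟨ cong (a *_) (cong₂ _+_ (*-identityʳ a) (sum-zero {m})) ⟩
    a * (a + 0)                               ≡⟨ cong (a *_) (+-identityʳ a) ⟩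
    a * a                                     ∎
  tail : sum (λ i → card (same (a ∷ as) (a ↑ʳ i))) ≡ sumSq as
  tail = begin
    sum (λ i → card (same (a ∷ as) (a ↑ʳ i))) ≡⟨ sum-cong-≗ (λ i → rows (a ↑ʳ i) (right i)) ⟩
    sum (λ i → a * 0 + card (same as i))      ≡⟨ sum-cong-≗ (λ i → cong (_+ card (same as i)) (*-zeroʳ a)) ⟩
    sum (λ i → card (same as i))              ≡⟨ same-total as ⟩
    sumSq as                                  ∎

multipartite : (as : List ℕ) → Graph (List.sum as)
multipartite as = record
  { adj    = λ i j → not (same as i j)
  ; sym    = λ i j → cong not (≟-sym (colour as i) (colour as j))
  ; irrefl = λ i → cong not (dec-true (colour as i ≟ colour as i) refl)
  }
  where
  ≟-sym : ∀ {m} (p q : Fin m) → does (p ≟ q) ≡ does (q ≟ p)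
  ≟-sym p q with p ≟ q
  ... | yes refl = ≡-sym (dec-true (q ≟ q) refl)
  ... | no p≢q   = ≡-sym (dec-false (q ≟ p) (p≢q ∘ ≡-sym))

multipartite-clique-free : (as : List ℕ) {k : ℕ} → length as < k → ¬ HasClique k (multipartite as)
multipartite-clique-free as l<k (f , inj , f~f)
  with i , j , i<j , e ← pigeonhole l<k (colour as ∘ f) =
  true≢false (f~f i j (Fin.<⇒≢ i<j)) (cong not (dec-true (colour as (f i) ≟ colour as (f j)) e))

multipartite-graph : (as : List ℕ) {κ : ℕ} → length as ≤ κ → List.sum as ≡ n →
                     Σ (Graph n) λ H → ¬ HasClique (suc κ) H × sum (codeg H) ≡ sumSq as
multipartite-graph as l≤κ refl = multipartite as , multipartite-clique-free as (s≤s l≤κ)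
  , trans (sum-cong-≗ λ i → sum-cong-≗ λ j → cong ⟦_⟧ (Bool.not-involutive (same as i j))) (same-total as)

-- K holds the vertices chosen so far, as their codegrees, W their common neighbours. W has x vertices
-- more than the n − Σ as left over by parts of sizes as, and the potential charges these to a vertex of W.
record Greedy (G : Graph n) (i : ℕ) : Set where
  field
    K W       : Fin n → Bool
    as        : List ℕ
    length-as : length as ≡ i
    card-K    : card K ≡ i
    K-clique  : IsClique G K
    K~W       : ∀ k w → K k ≡ true → W w ≡ true → Adj G k w
    weight-K  : weight K (codeg G) ≡ List.sum as
    sum<n     : List.sum as < n
    x         : ℕ
    card-W    : card W + List.sum as ≡ n + x
    potential : ∀ w → W w ≡ true → sumSq as ≤ weight (not ∘ W) (codeg G) + x * codeg G w

greedy-init : (G : Graph n) → 0 < n → Greedy G 0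
greedy-init {n} G 0<n = record
  { K         = λ _ → false
  ; W         = λ _ → true
  ; as        = []
  ; length-as = refl
  ; card-K    = sum-zero {n}
  ; K-clique  = λ _ _ ()
  ; K~W       = λ _ _ ()
  ; weight-K  = sum-zero {n}
  ; sum<n     = 0<n
  ; x         = 0
  ; card-W    = cong (_+ 0) (card-full {n})
  ; potential = λ _ _ → z≤n
  }

module _ {κ : ℕ} (G : Graph n)
         (extremal : (H : Graph n) → ¬ HasClique (suc κ) H → sum (codeg G) < sum (codeg H)) where

  -- The next vertex `v` has the least codegree in `W`. Either its codegree still fits below `n` and
  -- the invariants are updated, or `stuck` beats the extremal bound.
  greedy-step : {i : ℕ} → i < κ → Greedy G i → Greedy G (suc i)
  greedy-step {i} i<κ S = extend (a + s <? n)
    where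
    open Greedy S
    s = List.sum as
    O = weight (not ∘ W) (codeg G)

    W-nonempty : ∃ λ v → W v ≡ true
    W-nonempty = card-nonempty W (+-cancelʳ-< s 0 (card W)
      (<-≤-trans sum<n (≤-trans (m≤m+n n x) (≤-reflexive (≡-sym card-W)))))

    best : ∃ λ v → W v ≡ true × (∀ w → W w ≡ true → codeg G v ≤ codeg G w)
    best = argmin W (codeg G) W-nonempty
    v = proj₁ best
    v∈W = proj₁ (proj₂ best)
    v-least = proj₂ (proj₂ best)
    a = codeg G v

    total-codeg : sum (codeg G) ≡ O + weight W (codeg G)
    total-codeg = trans (sum-cong-≗ λ j → split (W j) (codeg G j))
                    (∑-distrib-+ (λ j → ⟦ not (W j) ⟧ * codeg G j) (λ j → ⟦ W j ⟧ * codeg G j))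
      where
      split : ∀ b c → c ≡ ⟦ not b ⟧ * c + ⟦ b ⟧ * c
      split true  c = ≡-sym (+-identityʳ c)
      split false c = ≡-sym (trans (+-identityʳ (c + 0)) (+-identityʳ c))

    -- The last part takes the remaining `r` vertices, and `r ≤ a`. By the potential at `v`, the
    -- codegree sum of `H` is at most `O + (r + x) * a`. Since `W` has exactly `r + x` vertices,
    -- each of codegree at least `a`, the graph `G` reaches this amount, against `extremal`.
    stuck : ¬ n ≤ a + s
    stuck n≤a+s with r , s+r≡n ← m≤n⇒∃[o]m+o≡n (<⇒≤ sum<n)
      with H , H-free , H-codeg ← multipartite-graph (r ∷ as) {κ} (subst (_< κ) (≡-sym length-as) i<κ)
             (trans (+-comm r s) s+r≡n) =
      <⇒≱ (extremal H H-free) (begin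
        sum (codeg H)          ≡⟨ H-codeg ⟩
        r * r + sumSq as       ≤⟨ +-mono-≤ (*-monoʳ-≤ r r≤a) (potential v v∈W) ⟩
        r * a + (O + x * a)    ≡⟨ regroup r a O x ⟩
        O + (r + x) * a        ≡⟨ cong (λ c → O + c * a) card-W≡ ⟨
        O + card W * a         ≤⟨ +-monoʳ-≤ O (weight-≥ v-least) ⟩
        O + weight W (codeg G) ≡⟨ total-codeg ⟨
        sum (codeg G)          ∎)
      where
      open ≤-Reasoning
      r≤a : r ≤ a
      r≤a = +-cancelˡ-≤ s r a (≤-trans (≤-reflexive s+r≡n) (≤-trans n≤a+s (≤-reflexive (+-comm a s))))
      regroup : ∀ r a O x → r * a + (O + x * a) ≡ O + (r + x) * a
      regroup = solve-∀
      card-W≡ : card W ≡ r + x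
      card-W≡ = +-cancelʳ-≡ s (card W) (r + x)
        (trans card-W (trans (cong (_+ x) (≡-sym s+r≡n)) (rotate s r x)))
        where
        rotate : ∀ s r x → s + r + x ≡ r + x + s
        rotate = solve-∀

    K′ W′ L : Fin n → Bool
    K′ j = K j ∨ is v j
    W′ j = W j ∧ adj G v j
    L  j = W j ∧ not (adj G v j)

    weight-K′ : (g : Fin n → ℕ) → weight K′ g ≡ g v + weight K g
    weight-K′ g = trans (sum-cong-≗ split)
      (trans (∑-distrib-+ (λ j → ⟦ is v j ⟧ * g j) (λ j → ⟦ K j ⟧ * g j)) (cong (_+ weight K g) (sum-is v g)))
      where
      split : ∀ j → ⟦ K′ j ⟧ * g j ≡ ⟦ is v j ⟧ * g j + ⟦ K j ⟧ * g j
      split j with K j in p | is v j in q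
      ... | false | false = refl
      ... | false | true  = ≡-sym (+-identityʳ _)
      ... | true  | false = refl
      ... | true  | true  with refl ← is⇒≡ v j q = contradiction (K~W v v p v∈W) (Adj-irrefl G refl)

    card≡weight : (P : Fin n → Bool) → card P ≡ weight P (λ _ → 1)
    card≡weight P = sum-cong-≗ λ j → ≡-sym (*-identityʳ ⟦ P j ⟧)

    card-K′ : card K′ ≡ suc i
    card-K′ = trans (card≡weight K′) (trans (weight-K′ (λ _ → 1)) (cong suc (trans (≡-sym (card≡weight K)) card-K)))

    K′-clique : IsClique G K′
    K′-clique j l p q j≢l with ∨-split {K j} p | ∨-split {K l} q
    ... | inj₁ j∈K | inj₁ l∈K = K-clique j l j∈K l∈K j≢l
    ... | inj₁ j∈K | inj₂ l≡v rewrite is⇒≡ v l l≡v = K~W j v j∈K v∈W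
    ... | inj₂ j≡v | inj₁ l∈K rewrite is⇒≡ v j j≡v = Adj-sym G (K~W l v l∈K v∈W)
    ... | inj₂ j≡v | inj₂ l≡v = contradiction (trans (is⇒≡ v j j≡v) (≡-sym (is⇒≡ v l l≡v))) j≢l

    K′~W′ : ∀ k w → K′ k ≡ true → W′ w ≡ true → Adj G k w
    K′~W′ k w p q with w∈W , v~w ← ∧-split {W w} q with ∨-split {K k} p
    ... | inj₁ k∈K = K~W k w k∈K w∈W
    ... | inj₂ k≡v rewrite is⇒≡ v k k≡v = v~w

    card-L≤a : card L ≤ a
    card-L≤a = card-mono {P = L} λ j → proj₂ ∘ ∧-split {W j}

    -- `y` is the number of non-neighbours of `v` outside `W`, by which `W` shrinks less than a full
    -- part would require; it is added to the surplus `x`.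
    y = proj₁ (m≤n⇒∃[o]m+o≡n card-L≤a)
    a≡ : card L + y ≡ a
    a≡ = proj₂ (m≤n⇒∃[o]m+o≡n card-L≤a)

    card-W-split : card W ≡ card W′ + card L
    card-W-split = trans (sum-cong-≗ λ j → split (W j) (adj G v j)) (∑-distrib-+ (λ j → ⟦ W′ j ⟧) (λ j → ⟦ L j ⟧))
      where
      split : ∀ b e → ⟦ b ⟧ ≡ ⟦ b ∧ e ⟧ + ⟦ b ∧ not e ⟧
      split false e     = refl
      split true  true  = refl
      split true  false = refl

    card-W′ : card W′ + (a + s) ≡ n + (x + y)
    card-W′ = begin
      card W′ + (a + s)             ≡⟨ cong (λ c → card W′ + (c + s)) a≡ ⟨
      card W′ + (card L + y + s)    ≡⟨ regroup (card W′) (card L) y s ⟩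
      card W′ + card L + s + y      ≡⟨ cong (λ c → c + s + y) card-W-split ⟨
      card W + s + y                ≡⟨ cong (_+ y) card-W ⟩
      n + x + y                     ≡⟨ +-assoc n x y ⟩
      n + (x + y)                   ∎
      where
      open ≡-Reasoning
      regroup : ∀ w l y s → w + (l + y + s) ≡ w + l + s + y
      regroup = solve-∀

    O′ = weight (not ∘ W′) (codeg G)

    O′-split : O′ ≡ O + weight L (codeg G)
    O′-split = trans (sum-cong-≗ λ j → split (W j) (adj G v j) (codeg G j))
                 (∑-distrib-+ (λ j → ⟦ not (W j) ⟧ * codeg G j) (λ j → ⟦ L j ⟧ * codeg G j))
      where
      split : ∀ b e c → ⟦ not (b ∧ e) ⟧ * c ≡ ⟦ not b ⟧ * c + ⟦ b ∧ not e ⟧ * c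
      split false e     c = ≡-sym (+-identityʳ (c + 0))
      split true  true  c = refl
      split true  false c = refl

    -- The new square is `(card L + y) * a`. The vertices of `L` leave `W` and pay `card L * a`, as
    -- each has codegree at least `a`; the other `y * a` is charged to `w`, whose codegree is also
    -- at least `a`.
    potential′ : ∀ w → W′ w ≡ true → a * a + sumSq as ≤ O′ + (x + y) * codeg G w
    potential′ w w∈W′ = begin
      a * a + sumSq as                      ≡⟨ cong (λ c → c * a + sumSq as) a≡ ⟨
      (card L + y) * a + sumSq as           ≤⟨ +-monoʳ-≤ ((card L + y) * a) (potential w w∈W) ⟩
      (card L + y) * a + (O + x * b)        ≡⟨ regroup (card L) y a O x b ⟩
      O + card L * a + (x * b + y * a)      ≤⟨ +-mono-≤ (+-monoʳ-≤ O (weight-≥ {P = L} λ j → v-least j ∘ proj₁ ∘ ∧-split {W j}))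
                                                 (+-monoʳ-≤ (x * b) (*-monoʳ-≤ y (v-least w w∈W))) ⟩
      O + weight L (codeg G) + (x * b + y * b) ≡⟨ cong₂ _+_ O′-split (*-distribʳ-+ b x y) ⟨
      O′ + (x + y) * b                      ∎
      where
      open ≤-Reasoning
      b = codeg G w
      w∈W = proj₁ (∧-split {W w} w∈W′)
      regroup : ∀ l y a O x b → (l + y) * a + (O + x * b) ≡ O + l * a + (x * b + y * a)
      regroup = solve-∀

    extend : Dec (a + s < n) → Greedy G (suc i)
    extend (no ¬lt)  = ⊥-elim (stuck (≮⇒≥ ¬lt))
    extend (yes lt) = record
      { K         = K′
      ; W         = W′
      ; as        = a ∷ as
      ; length-as = cong suc length-as
      ; card-K    = card-K′
      ; K-clique  = K′-clique
      ; K~W       = K′~W′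
      ; weight-K  = trans (weight-K′ (codeg G)) (cong (a +_) weight-K)
      ; sum<n     = lt
      ; x         = x + y
      ; card-W    = card-W′
      ; potential = potential′
      }

  greedy : 0 < n → (i : ℕ) → i ≤ κ → Greedy G i
  greedy 0<n zero    _   = greedy-init G 0<n
  greedy 0<n (suc i) i<κ = greedy-step i<κ (greedy 0<n i (<⇒≤ i<κ))

-- Comparison of the edge counts

sum-deg+codeg : (G : Graph n) → sum (deg G) + sum (codeg G) ≡ n * n
sum-deg+codeg {n} G = trans (≡-sym (∑-distrib-+ (deg G) (codeg G))) (trans (sum-cong-≗ (deg+codeg G)) (sum-const {n} n))

edges-<⇒codeg-> : (G H : Graph n) → edges H < edges G → sum (codeg G) < sum (codeg H)
edges-<⇒codeg-> G H lt = ≰⇒> λ le → <⇒≢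
  (+-mono-<-≤ (subst (_< sum (deg G)) (edges-double H) (subst (edges H + edges H <_) (edges-double G) (+-mono-< lt lt))) le)
  (trans (sum-deg+codeg H) (≡-sym (sum-deg+codeg G)))

theorem8 : (κ : ℕ) → 2 ≤ κ →
    Σ ℕ λ n₀ → (n : ℕ) → n₀ ≤ n → (G : Graph n) →
    (t t' : ℕ) → IsTuranNumber κ n t → IsTuranNumber (suc κ) n t' →
    suc t ≤ edges G → edges G ≤ t' →
    (F : Graph n) → IsMaxChordalSubgraph F G → HasClique (suc κ) F
-- The threshold is `n₀ = κ`: it makes the vertex set nonempty for the greedy choice and is the
-- range in which `cap-bound` is proved.
theorem8 κ@(suc μ) 2≤κ = κ , λ n κ≤n G t t' (_ , t-max) _ t<m _ F (_ , F-chordal , F-max) →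
  let
    extremal : (H : Graph n) → ¬ HasClique (suc κ) H → sum (codeg G) < sum (codeg H)
    extremal H free = edges-<⇒codeg-> G H (≤-<-trans (t-max H free) t<m)
    S = greedy G extremal (≤-trans (s≤s z≤n) κ≤n) κ ≤-refl
    open Greedy S
    cone≤F = F-max (cone G K) (cone-⊆ G K) (cone-chordal G K K-clique)
  in [ id , (λ small → ⊥-elim (too-many-edges n κ≤n G F S cone≤F small)) ]′ (chordal-edges F F-chordal μ)
  where
  -- The correction `κ * μ` enters once from `cone-edges` and once from `cap-bound`, so it cancels
  -- and the contradiction rests on `D> : μ * n < D` alone.
  too-many-edges : ∀ n → κ ≤ n → (G F : Graph n) (S : Greedy G κ) → edges (cone G (Greedy.K S)) ≤ edges F →
           sum (deg F) ≤ cap μ n + cap μ n → ⊥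
  too-many-edges n κ≤n G F S cone≤F small = <-irrefl refl (begin-strict
      D + D                                      ≤⟨ cone-edges G K ⟩
      sum (deg (cone G K)) + card K * pred (card K) ≡⟨ cong₂ _+_ (≡-sym (edges-double (cone G K))) (cong (λ k → k * pred k) card-K) ⟩
      edges (cone G K) + edges (cone G K) + κ * μ ≤⟨ +-monoˡ-≤ (κ * μ) (+-mono-≤ cone≤F cone≤F) ⟩
      edges F + edges F + κ * μ                  ≡⟨ cong (_+ κ * μ) (edges-double F) ⟩
      sum (deg F) + κ * μ                        ≤⟨ +-monoˡ-≤ (κ * μ) small ⟩
      cap μ n + cap μ n + κ * μ                  ≤⟨ cap-bound μ n κ≤n ⟩
      μ * n + μ * n                              <⟨ +-mono-< D> D> ⟩
      D + D                                      ∎)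
    where
    open ≤-Reasoning
    open Greedy S
    D = weight K (deg G)
    -- Degree and codegree add up to `n` at each of the `κ = suc μ` clique vertices; as the
    -- codegrees sum to less than `n`, the degrees exceed `μ * n`.
    D+codeg : D + List.sum as ≡ n + μ * n
    D+codeg = trans (cong (D +_) (≡-sym weight-K))
      (trans (≡-sym (∑-distrib-+ (λ j → ⟦ K j ⟧ * deg G j) (λ j → ⟦ K j ⟧ * codeg G j)))
      (trans (sum-cong-≗ λ j → trans (≡-sym (*-distribˡ-+ ⟦ K j ⟧ (deg G j) (codeg G j)))
                                     (cong (⟦ K j ⟧ *_) (deg+codeg G j)))
      (trans (≡-sym (*-distribʳ-sum n (λ j → ⟦ K j ⟧))) (cong (_* n) card-K))))
    D> : μ * n < D
    D> = +-cancelʳ-< (List.sum as) (μ * n) D (<-≤-trans (+-monoʳ-< (μ * n) sum<n)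
           (≤-reflexive (trans (+-comm (μ * n) n) (≡-sym D+codeg))))
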